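{- Orthogonal Vectors parameterized by the number $n$ of vectors is 2-OR-decomposable.
   Context: The notation $\widetilde O$ hides polylogarithmic factors. Orthogonal Vectors: given two size-$n$ sets $A,B\subseteq\{0,1\}^d$ for some $d\in\mathbb N$, decide whether there are $a\in A$ and $b\in B$ that are orthogonal, i.e., for each $i\in\{1,\dots,d\}$ the $i$-th coordinate of $a$ or the $i$-th coordinate of $b$ is zero. OR-decomposition: for $\alpha>1$, an $\alpha$-OR-decomposition for a problem $\mathcal P$ with parameter $n$ (a set of pairs $(I,n)$) is an algorithm that, given $\lambda>0$ and an instance $(I,n)$ of $\mathcal P$, computes, for some $\alpha'<\alpha$, in $\widetilde O(n^{\alpha'})$ time $t\in\widetilde O(n^{\alpha\lambda/(\alpha+\lambda)})$ many instances $(I_1,n_1),\dots,(I_t,n_t)$ of $\mathcal P$ such that (i) $(I,n)\in\mathcal P$ if and only if $(I_i,n_i)\in\mathcal P$ for some $i\in\{1,\dots,t\}$, and (ii) $n_i\in\widetilde O(n^{\alpha/(\alpha+\lambda)})$ for all $i$. The problem $\mathcal P$ is $\alpha$-OR-decomposable if an $\alpha$-OR-decomposition for it exists.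
   Formalization: The parameter λ > 0 given to the OR-decomposition ranges over positive rational numbers only, rather than over all positive reals. -}

module Defs where

open import Data.Bool using (Bool; true; false; if_then_else_)
open import Data.Fin using (Fin; toℕ)
open import Data.Integer using (+_; -[1+_]; ∣_∣)
open import Data.Nat using (ℕ; zero; suc; _+_; _*_; _∸_; _^_; _/_; _≡ᵇ_; _≤_; _<_; _≮_)
open import Data.Nat.Logarithm using (⌊log₂_⌋)
open import Data.Product using (Σ; ∃-syntax; _×_; _,_; proj₁; proj₂)
open import Data.Rational.Unnormalised as ℚᵘ using (ℚᵘ; mkℚᵘ; 1ℚᵘ; Positive; ↥_; ↧ₙ_)
import Data.Rational.Unnormalised.Properties as ℚᵘₚ
open import Data.Sum using (_⊎_; map)
open import Data.Vec using (Vec; lookup)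
open import Function.Bundles using (_⇔_)
open import Function.Definitions using (Injective)
open import Relation.Binary.PropositionalEquality
  using (_≡_; refl; sym; trans)

------------------------------------------------------------------------
-- Word RAM

Register Memory : Set
Register = ℕ
Memory   = ℕ → ℕ

record State : Set where
  constructor ⟨_,_⟩
  field
    regs : ℕ → ℕ
    mem  : Memory

open State public

data Operand : Set where
  reg : Register → Operand
  lit : ℕ → Operand

data Op : Set where
  add monus mul div : Op

data Cmd : Set where
  skip         : Cmd
  _≔_⟨_⟩_      : Register → Operand → Op → Operand → Cmd
  load         : Register → Operand → Cmd
  store        : Operand → Operand → Cmd
  _⨾_          : Cmd → Cmd → Cmd
  ifLess       : Operand → Operand → Cmd → Cmd → Cmd
  whileLess    : Operand → Operand → Cmd → Cmd

infixr 4 _⨾_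
infix  5 _≔_⟨_⟩_

-- Division by zero yields zero.
applyOp : Op → ℕ → ℕ → ℕ
applyOp add   m n       = m + n
applyOp monus m n       = m ∸ n
applyOp mul   m n       = m * n
applyOp div   m zero    = 0
applyOp div   m (suc n) = m / suc n

eval : Operand → State → ℕ
eval (reg x) σ = regs σ x
eval (lit k) σ = k

update : (ℕ → ℕ) → ℕ → ℕ → (ℕ → ℕ)
update f x v y = if y ≡ᵇ x then v else f y

setReg setMem : State → ℕ → ℕ → State
setReg ⟨ r , m ⟩ x v = ⟨ update r x v , m ⟩
setMem ⟨ r , m ⟩ a v = ⟨ r , update m a v ⟩

infix 3 _⊢_,_⇓_,_

-- W ⊢ c , σ ⇓ τ , t : started in σ, the command c halts in τ after t unit-cost
-- steps, and every value or address it handles is a word, i.e. less than W.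
-- There is no rule for an overflow: such a computation has no outcome at all.
data _⊢_,_⇓_,_ (W : ℕ) : Cmd → State → State → ℕ → Set where

  ⇓skip : ∀ {σ} → W ⊢ skip , σ ⇓ σ , 1

  ⇓assign : ∀ {σ x a o b} →
    applyOp o (eval a σ) (eval b σ) < W →
    W ⊢ x ≔ a ⟨ o ⟩ b , σ ⇓ setReg σ x (applyOp o (eval a σ) (eval b σ)) , 1

  ⇓load : ∀ {σ x a} →
    eval a σ < W → mem σ (eval a σ) < W →
    W ⊢ load x a , σ ⇓ setReg σ x (mem σ (eval a σ)) , 1

  ⇓store : ∀ {σ a b} →
    eval a σ < W → eval b σ < W →
    W ⊢ store a b , σ ⇓ setMem σ (eval a σ) (eval b σ) , 1

  ⇓seq : ∀ {ρ σ τ c d s t} →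
    W ⊢ c , ρ ⇓ σ , s → W ⊢ d , σ ⇓ τ , t →
    W ⊢ c ⨾ d , ρ ⇓ τ , s + t

  ⇓then : ∀ {σ τ a b c d t} →
    eval a σ < eval b σ → W ⊢ c , σ ⇓ τ , t →
    W ⊢ ifLess a b c d , σ ⇓ τ , 1 + t

  ⇓else : ∀ {σ τ a b c d t} →
    eval a σ ≮ eval b σ → W ⊢ d , σ ⇓ τ , t →
    W ⊢ ifLess a b c d , σ ⇓ τ , 1 + t

  ⇓done : ∀ {σ a b c} →
    eval a σ ≮ eval b σ →
    W ⊢ whileLess a b c , σ ⇓ σ , 1

  ⇓loop : ∀ {ρ σ τ a b c s t} →
    eval a ρ < eval b ρ →
    W ⊢ c , ρ ⇓ σ , s → W ⊢ whileLess a b c , σ ⇓ τ , t →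
    W ⊢ whileLess a b c , ρ ⇓ τ , 1 + (s + t)

------------------------------------------------------------------------
-- Parameterized problems

-- The pairs (I , n) are given by I : Instance n, and the problem itself is the
-- set of those pairs that satisfy Yes.
-- Represents N m a I : the memory m holds the pair (I , n) at address a, using
-- only cells with addresses below N.
record Problem : Set₁ where
  field
    Instance    : ℕ → Set
    Yes         : ∀ {n} → Instance n → Set
    Represents  : ℕ → Memory → ℕ → ∀ {n} → Instance n → Set
    unambiguous : ∀ {N N′ m a n n′} {I : Instance n} {I′ : Instance n′} →
                  Represents N m a I → Represents N′ m a I′ →
                  n ≡ n′ × (Yes I → Yes I′)

------------------------------------------------------------------------
-- Soft-O

infix 3 _≤[_·_^_] _∈Õ[_^_]

-- m ≤[ K · n ^ β ] is the real inequality m ≤ K · n^β, raised to the power of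
-- the denominator of β (and, for β < 0, multiplied by the power of n).
_≤[_·_^_] : ℕ → ℕ → ℕ → ℚᵘ → Set
m ≤[ K · n ^ mkℚᵘ (+ u)    v-1 ] = m ^ suc v-1 ≤ K ^ suc v-1 * n ^ u
m ≤[ K · n ^ mkℚᵘ -[1+ u ] v-1 ] = m ^ suc v-1 * n ^ suc u ≤ K ^ suc v-1

-- f x ∈ Õ(n(x)^β), uniformly over all x in X.  The offset 1 + log only matters
-- at n = 1, and n = 0 is excluded because 0^β = 0 there.
_∈Õ[_^_] : {X : Set} → (X → ℕ) → (X → ℕ) → ℚᵘ → Set
f ∈Õ[ n ^ β ] = ∃[ C ] ∃[ k ] ∀ x → 1 ≤ n x →
  f x ≤[ C * (1 + ⌊log₂ n x ⌋) ^ k · n x ^ β ]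

------------------------------------------------------------------------
-- OR-decompositions

module _ (P : Problem) where
  open Problem P

  -- An input (I , n) together with λ = lam.  Cells from address `free` on hold
  -- arbitrary words, so they cannot carry advice.
  record Input (lam : ℚᵘ) : Set where
    field
      {n}       : ℕ
      inst      : Instance n
      memory    : Memory
      address   : ℕ
      free      : ℕ
      encoded   : Represents free memory address inst
      U         : ℕ
      memory<U  : ∀ a → memory a < U
      address<U : address < U
      free<U    : free < U
      num<U     : ∣ ↥ lam ∣ < U
      den<U     : ↧ₙ lam < U

    initial : State
    initial = ⟨ start , memory ⟩
      where
      start : ℕ → ℕ
      start 0 = ∣ ↥ lam ∣
      start 1 = ↧ₙ lam
      start 2 = address
      start 3 = free
      start _ = 0

  -- On halting, register 0 holds the number t of computed instances and
  -- register 1 the address of a table of t pointers to them.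
  -- Words have c times as many bits as are needed for the input words, i.e. the
  -- word length is logarithmic in the input when U is taken as small as possible.
  record Outcome (program : Cmd) (c : ℕ) {lam : ℚᵘ} (x : Input lam) : Set where
    open Input x using (inst; U; initial)

    field
      final : State
      steps : ℕ
      halts : U ^ c ⊢ program , initial ⇓ final , steps

    count : ℕ
    count = regs final 0

    table : ℕ
    table = regs final 1

    field
      table-fits : table + count ≤ U ^ c
      param      : Fin count → ℕ
      output     : (i : Fin count) → Instance (param i)
      encoded    : ∀ i → Represents (U ^ c) (mem final) (mem final (table + toℕ i)) (output i)
      correct    : Yes inst ⇔ (∃[ i ] Yes (output i))

private
  denominator≢0 : ∀ {α lam} → 1ℚᵘ ℚᵘ.< α → Positive lam → ℚᵘ.NonZero (α ℚᵘ.+ lam)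
  denominator≢0 {α} {lam} 1<α lam>0 =
    ℚᵘₚ.pos⇒nonZero (α ℚᵘ.+ lam)
      {{ℚᵘₚ.pos+pos⇒pos α {{ℚᵘ.positive (ℚᵘₚ.<-trans (ℚᵘₚ.positive⁻¹ 1ℚᵘ) 1<α)}} lam {{lam>0}}}}

-- A single program serves every λ; α′ and the constants and exponents hidden
-- by Õ may depend on λ, but not on the instance.
record OR-Decomposable (α : ℚᵘ) (P : Problem) : Set where
  field
    1<α     : 1ℚᵘ ℚᵘ.< α
    program : Cmd
    c       : ℕ
    run     : ∀ lam → Positive lam → (x : Input P lam) → Outcome P program c x

    time-bound : ∀ lam (lam>0 : Positive lam) → ∃[ α′ ] α′ ℚᵘ.< α ×
      (λ x → Outcome.steps (run lam lam>0 x)) ∈Õ[ Input.n ^ α′ ]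

    count-bound : ∀ lam (lam>0 : Positive lam) →
      (λ x → Outcome.count (run lam lam>0 x))
        ∈Õ[ Input.n ^ ((α ℚᵘ.* lam) ℚᵘ.÷ (α ℚᵘ.+ lam)) {{denominator≢0 1<α lam>0}} ]

    size-bound : ∀ lam (lam>0 : Positive lam) →
      (λ ((x , i) : Σ (Input P lam) (λ x → Fin (Outcome.count (run lam lam>0 x)))) →
        Outcome.param (run lam lam>0 x) i)
        ∈Õ[ (λ (x , _) → Input.n x) ^ (α ℚᵘ.÷ (α ℚᵘ.+ lam)) {{denominator≢0 1<α lam>0}} ]

------------------------------------------------------------------------
-- Orthogonal Vectors

Orthogonal : ∀ {d} → Vec Bool d → Vec Bool d → Set
Orthogonal a b = ∀ i → lookup a i ≡ false ⊎ lookup b i ≡ false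

-- The sets A and B of size n are given by repetition-free enumerations.
record OVInstance (n : ℕ) : Set where
  field
    {d}    : ℕ
    A B    : Fin n → Vec Bool d
    A-inj  : Injective _≡_ _≡_ A
    B-inj  : Injective _≡_ _≡_ B

HasOrthogonalPair : ∀ {n} → OVInstance n → Set
HasOrthogonalPair I = ∃[ i ] ∃[ j ] Orthogonal (A i) (B j)
  where open OVInstance I

bit : Bool → ℕ
bit false = 0
bit true  = 1

VectorAt : ℕ → Memory → ℕ → ∀ {d} → Vec Bool d → Set
VectorAt N m p {d} v = p + d ≤ N × (∀ j → m (p + toℕ j) ≡ bit (lookup v j))

-- Layout: n, d, then n pointers to the vectors of A and n pointers to those of
-- B.  As in an array of references, several instances may share vectors; this is
-- what makes time bounds in n alone meaningful although d is unrestricted.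
record OVRepresents (N : ℕ) (m : Memory) (a : ℕ) {n} (I : OVInstance n) : Set where
  open OVInstance I
  field
    fits  : a + 2 + (n + n) ≤ N
    size  : m a ≡ n
    dim   : m (a + 1) ≡ d
    vecsA : ∀ i → VectorAt N m (m (a + 2 + toℕ i)) (A i)
    vecsB : ∀ i → VectorAt N m (m (a + 2 + n + toℕ i)) (B i)

private
  sameBit : ∀ {c} x y → c ≡ bit x → c ≡ bit y → x ≡ y
  sameBit false false _    _  = refl
  sameBit true  true  _    _  = refl
  sameBit false true  refl ()
  sameBit true  false refl ()

  ov-unambiguous : ∀ {N N′ m a n n′} {I : OVInstance n} {I′ : OVInstance n′} →
    OVRepresents N m a I → OVRepresents N′ m a I′ →
    n ≡ n′ × (HasOrthogonalPair I → HasOrthogonalPair I′)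
  ov-unambiguous R R′
    with trans (sym (OVRepresents.size R)) (OVRepresents.size R′)
       | trans (sym (OVRepresents.dim R)) (OVRepresents.dim R′)
  ... | refl | refl = refl , λ (i , j , a⊥b) → i , j , λ k → map
    (trans (sym (sameBit _ _ (proj₂ (OVRepresents.vecsA R i) k) (proj₂ (OVRepresents.vecsA R′ i) k))))
    (trans (sym (sameBit _ _ (proj₂ (OVRepresents.vecsB R j) k) (proj₂ (OVRepresents.vecsB R′ j) k))))
    (a⊥b k)

OrthogonalVectors : Problem
OrthogonalVectors = record
  { Instance    = OVInstance
  ; Yes         = HasOrthogonalPair
  ; Represents  = OVRepresents
  ; unambiguous = ov-unambiguous
  }

2ℚᵘ : ℚᵘ
2ℚᵘ = mkℚᵘ (+ 2) 0

{-# OPTIONS --safe #-}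
-- Split A and B into g = ⌈n/s⌉ groups of s vectors each, where s ≈ n^(2/(2+λ)), and
-- output one instance for each of the g² ≈ n^(2λ/(2+λ)) pairs of groups: an orthogonal
-- pair of the input lies in one of them.  The vectors are shared with the input, so
-- writing the output costs only O(g² s) = O(n^((2+2λ)/(2+λ))) steps, which is truly
-- subquadratic.
--
-- Powers such as n^(2q) with λ = p/q do not fit into a bounded number of words, so s
-- is rounded to a power of two: s = 2^e with e = ⌊2qk/(2q+p)⌋ and k = ⌊log₂ n⌋, where
-- k and e grow together in a single loop that maintains the remainder of the division.
module Submission where

open import Defs

open import Data.Bool using (Bool; true; false; T; if_then_else_)
open import Data.Empty using (⊥-elim)
open import Data.Fin using (Fin; toℕ; fromℕ<; combine; remQuot; cast)
open import Data.Fin.Properties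
  using (toℕ<n; toℕ-fromℕ<; toℕ-injective; toℕ-combine; remQuot-combine; combine-remQuot;
         toℕ-cast; cast-involutive)
open import Data.Integer as ℤ using (∣_∣)
open import Data.Nat
open import Data.Nat.Divisibility using (n∣m*n)
open import Data.Nat.DivMod hiding (_div_)
open import Data.Nat.Properties
open import Data.Nat.Tactic.RingSolver using (solve-∀)
open import Data.Product using (∃-syntax; _×_; _,_; proj₁; proj₂)
open import Data.Rational.Unnormalised as ℚᵘ using (ℚᵘ; mkℚᵘ; ↥_; ↧ₙ_)
open import Data.Unit using (tt)
open import Data.Vec using (Vec)
open import Function using (_∘_; _$_)
open import Function.Bundles using (_⇔_; mk⇔; module Equivalence)
open import Function.Definitions using (Injective)
open import Relation.Binary.PropositionalEquality
open import Relation.Nullary using (yes; no; contradiction)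

-- Execution rules

update-≡ : ∀ f x v → update f x v x ≡ v
update-≡ f x v with x ≡ᵇ x in eq
... | true  = refl
... | false = ⊥-elim (subst T eq (≡⇒≡ᵇ x x refl))

update-≢ : ∀ f {x y} v → y ≢ x → update f x v y ≡ f y
update-≢ f {x} {y} v y≢x with y ≡ᵇ x in eq
... | true  = contradiction (≡ᵇ⇒≡ y x (subst T (sym eq) tt)) y≢x
... | false = refl

-- Bounds the number of steps if every loop makes at most N iterations.
cost : ℕ → Cmd → ℕ
cost N skip             = 1
cost N (_ ≔ _ ⟨ _ ⟩ _)  = 1
cost N (load _ _)       = 1
cost N (store _ _)      = 1
cost N (c ⨾ d)          = cost N c + cost N d
cost N (ifLess _ _ c d) = 1 + (cost N c + cost N d)
cost N (whileLess _ _ c) = 1 + N * (1 + cost N c)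

module Execution (W N : ℕ) where

  -- A total-correctness triple for one start state, with the step count bounded syntactically by
  -- `cost`.
  Runs : Cmd → State → (State → Set) → Set
  Runs c σ P = ∃[ τ ] (∃[ t ] W ⊢ c , σ ⇓ τ , t × t ≤ cost N c) × P τ

  runs-skip : ∀ {σ P} → P σ → Runs skip σ P
  runs-skip p = _ , (_ , ⇓skip , ≤-refl) , p

  -- The value `v` is chosen by the caller, so the new register content is recorded in a convenient
  -- form instead of as an expression over old registers.
  runs-assign : ∀ {σ P x a o b} v →
    applyOp o (eval a σ) (eval b σ) ≡ v → v < W →
    P (setReg σ x v) → Runs (x ≔ a ⟨ o ⟩ b) σ P
  runs-assign _ refl v<W p = _ , (_ , ⇓assign v<W , ≤-refl) , p

  runs-load : ∀ {σ P x a} i v → eval a σ ≡ i → mem σ i ≡ v → i < W → v < W →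
    P (setReg σ x v) → Runs (load x a) σ P
  runs-load _ _ refl refl i<W v<W p = _ , (_ , ⇓load i<W v<W , ≤-refl) , p

  runs-store : ∀ {σ P a b} i v → eval a σ ≡ i → eval b σ ≡ v → i < W → v < W →
    P (setMem σ i v) → Runs (store a b) σ P
  runs-store _ _ refl refl i<W v<W p = _ , (_ , ⇓store i<W v<W , ≤-refl) , p

  infixr 4 _⟫_

  _⟫_ : ∀ {σ P Q c d} → Runs c σ P → (∀ {τ} → P τ → Runs d τ Q) → Runs (c ⨾ d) σ Q
  (_ , (_ , c⇓ , s≤) , p) ⟫ f with f p
  ... | _ , (_ , d⇓ , t≤) , q = _ , (_ , ⇓seq c⇓ d⇓ , +-mono-≤ s≤ t≤) , q

  runs-seq : ∀ {σ P c d} → Runs c σ (λ τ → Runs d τ P) → Runs (c ⨾ d) σ P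
  runs-seq r = r ⟫ λ q → q

  runs-if : ∀ {σ P a b c d} →
    (eval a σ < eval b σ → Runs c σ P) → (eval a σ ≮ eval b σ → Runs d σ P) →
    Runs (ifLess a b c d) σ P
  runs-if {σ} {a = a} {b} {c} {d} f g with eval a σ <? eval b σ
  ... | yes lt with f lt
  ...   | _ , (_ , c⇓ , t≤) , p =
          _ , (_ , ⇓then lt c⇓ , s≤s (≤-trans t≤ (m≤m+n _ (cost N d)))) , p
  runs-if {c = c} f g | no ge with g ge
  ...   | _ , (_ , d⇓ , t≤) , p =
          _ , (_ , ⇓else ge d⇓ , s≤s (≤-trans t≤ (m≤n+m _ (cost N c)))) , p

  -- The index of the invariant counts completed iterations. Since a true guard must imply `k < N`,
  -- the difference between `N` and `k` is a termination measure.
  runs-while : ∀ {P a b c σ} (Inv : ℕ → State → Set) →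
    (∀ {k τ} → Inv k τ → eval a τ < eval b τ → k < N × Runs c τ (Inv (suc k))) →
    (∀ {k τ} → Inv k τ → eval a τ ≮ eval b τ → P τ) →
    Inv 0 σ → Runs (whileLess a b c) σ P
  runs-while {P} {a} {b} {c} Inv body exit = iterate N 0 refl
    where
    iterate : ∀ fuel k {τ} → k + fuel ≡ N → Inv k τ →
      ∃[ τ′ ] (∃[ t ] W ⊢ whileLess a b c , τ ⇓ τ′ , t × t ≤ 1 + fuel * (1 + cost N c)) × P τ′
    iterate fuel k {τ} k+fuel≡N inv with eval a τ <? eval b τ
    iterate fuel k k+fuel≡N inv | no ge =
      _ , (_ , ⇓done ge , s≤s z≤n) , exit inv ge
    -- Without fuel `k` equals `N`, while a true guard gives `k < N`.
    iterate zero k k+fuel≡N inv | yes lt =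
      contradiction (trans (sym (+-identityʳ k)) k+fuel≡N) (<⇒≢ (proj₁ (body inv lt)))
    iterate (suc fuel) k k+fuel≡N inv | yes lt with proj₂ (body inv lt)
    ... | _ , (_ , c⇓ , s≤) , inv′
      with iterate fuel (suc k) (trans (sym (+-suc k fuel)) k+fuel≡N) inv′
    ...   | _ , (_ , w⇓ , t≤) , p =
            _ , (_ , ⇓loop lt c⇓ w⇓ , s≤s (≤-trans (+-mono-≤ s≤ t≤)
                   (≤-reflexive (+-suc (cost N c) (fuel * (1 + cost N c)))))) , p

-- Arithmetic

-- The counterpart of `ifLess` on values, for specifying what a branching program computes.
choose : ℕ → ℕ → ℕ → ℕ → ℕ
choose a b v w = if a <ᵇ b then v else w

choose-< : ∀ {a b v w} → a < b → choose a b v w ≡ v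
choose-< {a} {b} a<b with a <ᵇ b in eq
... | true  = refl
... | false = ⊥-elim (subst T eq (<⇒<ᵇ a<b))

choose-≮ : ∀ {a b v w} → a ≮ b → choose a b v w ≡ w
choose-≮ {a} {b} a≮b with a <ᵇ b in eq
... | true  = contradiction (<ᵇ⇒< a b (subst T (sym eq) tt)) a≮b
... | false = refl

-- The machine has no minimum instruction; two truncated subtractions replace it.
m⊓n≡m∸[m∸n] : ∀ m n → m ⊓ n ≡ m ∸ (m ∸ n)
m⊓n≡m∸[m∸n] m n = begin
  m ⊓ n                         ≡⟨ m+n∸n≡m (m ⊓ n) (m ∸ n) ⟨
  m ⊓ n + (m ∸ n) ∸ (m ∸ n)     ≡⟨ cong (λ k → k + (m ∸ n) ∸ (m ∸ n)) (⊓-comm m n) ⟩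
  n ⊓ m + (m ∸ n) ∸ (m ∸ n)     ≡⟨ cong (_∸ (m ∸ n)) (m⊓n+n∸m≡n n m) ⟩
  m ∸ (m ∸ n)                   ∎
  where open ≡-Reasoning

applyOp-div : ∀ m n .{{_ : NonZero n}} → applyOp div m n ≡ m / n
applyOp-div m (suc n) = refl

-- Phrased with `applyOp` so that it is literally what the program computes.
⌈_/_⌉ : ℕ → ℕ → ℕ
⌈ n / s ⌉ = applyOp div (n + s ∸ 1) s

applyOp-div-≤ : ∀ m n → applyOp div m n ≤ m
applyOp-div-≤ m zero    = z≤n
applyOp-div-≤ m (suc n) = m/n≤m m (suc n)

applyOp-div-*-≤ : ∀ m n → applyOp div m n * n ≤ m
applyOp-div-*-≤ m zero    = z≤n
applyOp-div-*-≤ m (suc n) = m/n*n≤m m (suc n)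

[m*n+o]/n≡m : ∀ m n {o} .{{_ : NonZero n}} → o < n → (m * n + o) / n ≡ m
[m*n+o]/n≡m m n {o} o<n = begin
  (m * n + o) / n       ≡⟨ +-distrib-/-∣ˡ o (n∣m*n m) ⟩
  m * n / n + o / n     ≡⟨ cong₂ _+_ (m*n/n≡m m n) (m<n⇒m/n≡0 o<n) ⟩
  m + 0                 ≡⟨ +-identityʳ m ⟩
  m                     ∎
  where open ≡-Reasoning

applyOp-div-combine : ∀ {g} (a b : Fin g) → applyOp div (g * toℕ a + toℕ b) g ≡ toℕ a
applyOp-div-combine {g@(suc _)} a b =
  trans (cong (λ m → (m + toℕ b) / g) (*-comm g (toℕ a))) ([m*n+o]/n≡m (toℕ a) g (toℕ<n b))

-- The exception is `n = 0`, where `s = 1` exceeds `n`; but then there are no groups.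
0<⌈n/s⌉⇒s≤n : ∀ n s .{{_ : NonZero s}} → s ≤ n ⊔ 1 → 0 < ⌈ n / s ⌉ → s ≤ n
0<⌈n/s⌉⇒s≤n zero    (suc zero)    _           ()
0<⌈n/s⌉⇒s≤n zero    (suc (suc s)) (s≤s ())
0<⌈n/s⌉⇒s≤n (suc n) s             s≤n⊔1       _ = subst (s ≤_) (cong suc (⊔-identityʳ n)) s≤n⊔1

⌈n/s⌉*s≤n+s : ∀ n s .{{_ : NonZero s}} → ⌈ n / s ⌉ * s ≤ n + s
⌈n/s⌉*s≤n+s n s@(suc _) = ≤-trans (m/n*n≤m (n + s ∸ 1) s) (m∸n≤m (n + s) 1)

n≤⌈n/s⌉*s : ∀ n s .{{_ : NonZero s}} → n ≤ ⌈ n / s ⌉ * s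
n≤⌈n/s⌉*s n s@(suc s-1) = +-cancelʳ-≤ s-1 n (⌈ n / s ⌉ * s) (begin
  n + s-1                                    ≡⟨ cong (_∸ 1) (+-suc n s-1) ⟨
  n + s ∸ 1                                  ≡⟨ m≡m%n+[m/n]*n (n + s ∸ 1) s ⟩
  (n + s ∸ 1) % s + ⌈ n / s ⌉ * s            ≤⟨ +-monoˡ-≤ _ (s≤s⁻¹ (m%n<n (n + s ∸ 1) s)) ⟩
  s-1 + ⌈ n / s ⌉ * s                        ≡⟨ +-comm s-1 _ ⟩
  ⌈ n / s ⌉ * s + s-1                        ∎)
  where open ≤-Reasoning

-- `e` and `acc` are quotient and remainder of `u * k` by `D`. The maximum with 1 admits `n = 0`,
-- for which `k = 0`.
record Rounding (n u D k e acc : ℕ) : Set where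
  constructor rounding
  field
    division  : acc + e * D ≡ u * k
    acc<D     : acc < D
    e≤k       : e ≤ k
    2^k≤n⊔1   : 2 ^ k ≤ n ⊔ 1

2^e≤n⊔1 : ∀ {n u D k e acc} → Rounding n u D k e acc → 2 ^ e ≤ n ⊔ 1
2^e≤n⊔1 (rounding _ _ e≤k 2^k≤n⊔1) = ≤-trans (^-monoʳ-≤ 2 e≤k) 2^k≤n⊔1

-- Word sizes as powers of `U`

module Words (U : ℕ) (2≤U : 2 ≤ U) where

  -- A record, so that i can be read off its type.
  record Small (i x : ℕ) : Set where
    constructor small
    field ≤U^ : x ≤ U ^ i

  open Small public

  private instance
    U-nonZero : NonZero U
    U-nonZero = >-nonZero (≤-trans (s≤s z≤n) 2≤U)

  word : ∀ {x} → x < U → Small 1 x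
  word x<U = small (≤-trans (<⇒≤ x<U) (≤-reflexive (sym (*-identityʳ U))))

  two : Small 1 2
  two = small (≤-trans 2≤U (≤-reflexive (sym (*-identityʳ U))))

  one : Small 1 1
  one = small (≤-trans (s≤s z≤n) (≤U^ two))

  smaller : ∀ {i x y} → x ≤ y → Small i y → Small i x
  smaller x≤y (small y≤) = small (≤-trans x≤y y≤)

  infixl 6 _+ˢ_
  infixl 7 _*ˢ_

  -- A sum is at most twice the larger bound, and the factor 2 is absorbed by one more factor `U`.
  _+ˢ_ : ∀ {i j x y} → Small i x → Small j y → Small (suc (i ⊔ j)) (x + y)
  _+ˢ_ {i} {j} {x} {y} (small x≤) (small y≤) = small (begin
    x + y                         ≤⟨ +-mono-≤ x≤ y≤ ⟩
    U ^ i + U ^ j                 ≤⟨ +-mono-≤ (^-monoʳ-≤ U (m≤m⊔n i j)) (^-monoʳ-≤ U (m≤n⊔m i j)) ⟩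
    U ^ (i ⊔ j) + U ^ (i ⊔ j)     ≡⟨ cong (U ^ (i ⊔ j) +_) (+-identityʳ _) ⟨
    2 * U ^ (i ⊔ j)               ≤⟨ *-monoˡ-≤ _ 2≤U ⟩
    U ^ suc (i ⊔ j)               ∎)
    where open ≤-Reasoning

  _*ˢ_ : ∀ {i j x y} → Small i x → Small j y → Small (i + j) (x * y)
  _*ˢ_ {i} {j} (small x≤) (small y≤) =
    small (≤-trans (*-mono-≤ x≤ y≤) (≤-reflexive (sym (^-distribˡ-+-* U i j))))

  -- For concrete exponents the hidden comparison reduces to the unit type and is filled in
  -- automatically.
  fits-in : ∀ {i x} w {_ : T (i <ᵇ w)} → Small i x → x < U ^ w
  fits-in {i} w {i<w} (small x≤) = ≤-<-trans x≤ (^-monoʳ-< U 2≤U (<ᵇ⇒< i w i<w))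

-- The program

-- Registers of phase₁: 4 = n, 5 = d, 6 = s = 2^e, 7 = n + 1, 8 = remainder, 9 = 2q,
-- 10 = 2q + p, 11 = 2^(k+1).
-- Registers of phase₂: 2 = address + 2, 12 = g, 13 = size of a block, 14 = size of all
-- blocks, 15 = number of cells, 16 = n - s, 17 = index of the next
-- cell; from 20 on temporaries.
-- Cell k of the output is stored at free + k and computed from k alone.  The cells form
-- g² blocks of 2 + 2s cells, which hold the instances, followed by the table.
doubling : Cmd
doubling =
  11 ≔ lit 2 ⟨ mul ⟩ reg 11 ⨾
  8 ≔ reg 8 ⟨ add ⟩ reg 9 ⨾
  ifLess (reg 8) (reg 10) skip
    (8 ≔ reg 8 ⟨ monus ⟩ reg 10 ⨾
     6 ≔ lit 2 ⟨ mul ⟩ reg 6)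

phase₁ : Cmd
phase₁ =
  load 4 (reg 2) ⨾
  5 ≔ reg 2 ⟨ add ⟩ lit 1 ⨾
  load 5 (reg 5) ⨾
  7 ≔ reg 4 ⟨ add ⟩ lit 1 ⨾
  9 ≔ lit 2 ⟨ mul ⟩ reg 1 ⨾
  10 ≔ reg 9 ⟨ add ⟩ reg 0 ⨾
  6 ≔ lit 1 ⟨ add ⟩ lit 0 ⨾
  11 ≔ lit 2 ⟨ add ⟩ lit 0 ⨾
  8 ≔ lit 0 ⟨ add ⟩ lit 0 ⨾
  whileLess (reg 11) (reg 7) doubling

-- Expects the group index in register 23 and, in register 24, the address that the start of the
-- group is to be added to. The two subtractions compute a minimum.
fetch : Cmd
fetch =
  23 ≔ reg 23 ⟨ mul ⟩ reg 6 ⨾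
  25 ≔ reg 23 ⟨ monus ⟩ reg 16 ⨾
  23 ≔ reg 23 ⟨ monus ⟩ reg 25 ⨾
  24 ≔ reg 24 ⟨ add ⟩ reg 23 ⨾
  load 20 (reg 24)

-- Register 21 holds the block number and register 22 the offset in the block, from which the two
-- header cells are subtracted first.
pointer : Cmd
pointer =
  22 ≔ reg 22 ⟨ monus ⟩ lit 2 ⨾
  23 ≔ reg 21 ⟨ div ⟩ reg 12 ⨾
  ifLess (reg 22) (reg 6)
    (24 ≔ reg 2 ⟨ add ⟩ reg 22)
    (24 ≔ reg 23 ⟨ mul ⟩ reg 12 ⨾
     23 ≔ reg 21 ⟨ monus ⟩ reg 24 ⨾
     24 ≔ reg 2 ⟨ add ⟩ reg 4 ⨾
     22 ≔ reg 22 ⟨ monus ⟩ reg 6 ⨾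
     24 ≔ reg 24 ⟨ add ⟩ reg 22) ⨾
  fetch

computeCell : Cmd
computeCell =
  ifLess (reg 17) (reg 14)
    (21 ≔ reg 17 ⟨ div ⟩ reg 13 ⨾
     22 ≔ reg 21 ⟨ mul ⟩ reg 13 ⨾
     22 ≔ reg 17 ⟨ monus ⟩ reg 22 ⨾
     ifLess (reg 22) (lit 2)
       (ifLess (reg 22) (lit 1)
         (20 ≔ reg 6 ⟨ add ⟩ lit 0)
         (20 ≔ reg 5 ⟨ add ⟩ lit 0))
       pointer)
    (20 ≔ reg 17 ⟨ monus ⟩ reg 14 ⨾
     20 ≔ reg 20 ⟨ mul ⟩ reg 13 ⨾
     20 ≔ reg 3 ⟨ add ⟩ reg 20)

writeCell : Cmd
writeCell =
  computeCell ⨾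
  21 ≔ reg 3 ⟨ add ⟩ reg 17 ⨾
  store (reg 21) (reg 20) ⨾
  17 ≔ reg 17 ⟨ add ⟩ lit 1

phase₂ : Cmd
phase₂ =
  12 ≔ reg 4 ⟨ add ⟩ reg 6 ⨾
  12 ≔ reg 12 ⟨ monus ⟩ lit 1 ⨾
  12 ≔ reg 12 ⟨ div ⟩ reg 6 ⨾
  0 ≔ reg 12 ⟨ mul ⟩ reg 12 ⨾
  13 ≔ lit 2 ⟨ mul ⟩ reg 6 ⨾
  13 ≔ lit 2 ⟨ add ⟩ reg 13 ⨾
  14 ≔ reg 0 ⟨ mul ⟩ reg 13 ⨾
  15 ≔ reg 14 ⟨ add ⟩ reg 0 ⨾
  16 ≔ reg 4 ⟨ monus ⟩ reg 6 ⨾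
  2 ≔ reg 2 ⟨ add ⟩ lit 2 ⨾
  1 ≔ reg 3 ⟨ add ⟩ reg 14 ⨾
  17 ≔ lit 0 ⟨ add ⟩ lit 0 ⨾
  whileLess (reg 17) (reg 15) writeCell

program : Cmd
program = phase₁ ⨾ phase₂

-- The values and addresses below are bounded by at most the ninth power of `U`, so 12 leaves some
-- room.
wordLength : ℕ
wordLength = 12

n<2^n : ∀ n → n < 2 ^ n
n<2^n zero    = s≤s z≤n
n<2^n (suc n) = begin-strict
  suc n           <⟨ s<s (n<2^n n) ⟩
  1 + 2 ^ n       ≤⟨ +-monoˡ-≤ (2 ^ n) (m^n>0 2 n) ⟩
  2 ^ n + 2 ^ n   ≡⟨ cong (2 ^ n +_) (+-identityʳ (2 ^ n)) ⟨
  2 ^ suc n       ∎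
  where open ≤-Reasoning

outputSize : ℕ → ℕ → ℕ
outputSize n s = ⌈ n / s ⌉ * ⌈ n / s ⌉ * (2 + 2 * s) + ⌈ n / s ⌉ * ⌈ n / s ⌉

-- Correctness of the program

module OnInput {lam : ℚᵘ} (x : Input OrthogonalVectors lam) where
  open Input x
  open OVInstance inst
  open OVRepresents encoded

  p q u D : ℕ
  p = ∣ ↥ lam ∣
  q = ↧ₙ lam
  u = 2 * q
  D = u + p

  0<q : 0 < q
  0<q = s≤s z≤n

  2≤U : 2 ≤ U
  2≤U = ≤-trans (s≤s 0<q) den<U

  open Words U 2≤U

  n<U : n < U
  n<U = subst (_< U) size (memory<U address)

  d<U : d < U
  d<U = subst (_< U) dim (memory<U (address + 1))

  n⊔1-small : Small 1 (n ⊔ 1)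
  n⊔1-small = word (⊔-pres-<m n<U 2≤U)

  -- First phase: rounding the group size to a power of two

  Setting₁ : State → Set
  Setting₁ σ = regs σ 2 ≡ address × regs σ 3 ≡ free × regs σ 4 ≡ n × regs σ 5 ≡ d ×
    regs σ 7 ≡ n + 1 × regs σ 9 ≡ u × regs σ 10 ≡ D × mem σ ≡ memory

  -- Register 11 is one power ahead of `k`, so that the guard tests whether `k` may still grow.
  Doubled : ℕ → State → Set
  Doubled k σ = Setting₁ σ × ∃[ e ] regs σ 6 ≡ 2 ^ e × regs σ 11 ≡ 2 ^ suc k ×
    Rounding n u D k e (regs σ 8)

  Rounded : State → Set
  Rounded σ = Setting₁ σ × ∃[ k ] ∃[ e ] regs σ 6 ≡ 2 ^ e × n < 2 ^ suc k × ∃[ acc ]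
    Rounding n u D k e acc

  module _ where
    -- The loop makes only logarithmically many iterations, but the crude bound `n` is later
    -- absorbed by the size of the output.
    open Execution (U ^ wordLength) n

    fit : ∀ {i y} → Small i y → {_ : T (i <ᵇ wordLength)} → y < U ^ wordLength
    fit y-small {i<} = fits-in wordLength {i<} y-small

    u-small : Small 2 u
    u-small = two *ˢ word den<U

    D-small : Small 3 D
    D-small = u-small +ˢ word num<U

    -- As `u ≤ D`, adding `u` to `acc < D` stays below `D + D`. One subtraction therefore restores
    -- the remainder, and `e` grows by at most one along with `k`, which preserves `e ≤ k`.
    runs-doubling : ∀ {k σ} → Doubled k σ → regs σ 11 < regs σ 7 →
      k < n × Runs doubling σ (Doubled (suc k))
    runs-doubling {k} {σ} (setting@(_ , _ , _ , _ , r7 , r9 , r10 , _) , e , r6 , r11 , rounding division acc<D e≤k 2^k≤) lt =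
      <-≤-trans (n<2^n k) (≤-trans (m≤m+n _ _) 2^1+k≤n) ,
      (runs-seq $ runs-assign (2 ^ (2 + k)) (cong (2 *_) r11) (fit (smaller (*-monoʳ-≤ 2 2^1+k≤n) (two *ˢ word n<U))) $
       runs-seq $ runs-assign (acc + u) (cong (acc +_) r9) (fit acc+u-small) $
       runs-if
        (λ below → runs-skip (setting , e , r6 , refl ,
          rounding (trans rearrange (sym (*-suc u k)))
            (subst (acc + u <_) r10 below) (m≤n⇒m≤1+n e≤k) (≤-trans 2^1+k≤n (m≤m⊔n n 1))))
        (λ above →
          let D≤ = ≮⇒≥ (subst (acc + u ≮_) r10 above) in
          runs-seq $ runs-assign (acc + u ∸ D) (cong (acc + u ∸_) r10) (fit (smaller (m∸n≤m (acc + u) D) acc+u-small)) $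
          runs-assign (2 ^ suc e) (cong (2 *_) r6)
            (fit (smaller (≤-trans (^-monoʳ-≤ 2 (s≤s e≤k)) 2^1+k≤n) (word n<U))) $
          setting , suc e , refl , refl ,
            rounding
              (begin-equality
                (acc + u ∸ D) + (D + e * D) ≡⟨ +-assoc (acc + u ∸ D) D (e * D) ⟨
                (acc + u ∸ D) + D + e * D   ≡⟨ cong (_+ e * D) (m∸n+n≡m D≤) ⟩
                acc + u + e * D             ≡⟨ rearrange ⟩
                u + u * k                   ≡⟨ *-suc u k ⟨
                u * suc k                   ∎)
              (m<n+o⇒m∸n<o (acc + u) D {{>-nonZero (≤-trans (s≤s z≤n) acc<D)}} (+-mono-<-≤ acc<D (m≤m+n u p)))
              (s≤s e≤k) (≤-trans 2^1+k≤n (m≤m⊔n n 1))))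
      where
      open ≤-Reasoning
      acc = regs σ 8
      2^1+k≤n : 2 ^ suc k ≤ n
      2^1+k≤n = s≤s⁻¹ (subst₂ _<_ r11 (trans r7 (+-comm n 1)) lt)
      acc+u-small : Small 4 (acc + u)
      acc+u-small = smaller (<⇒≤ acc<D) D-small +ˢ u-small
      rearrange : acc + u + e * D ≡ u + u * k
      rearrange = begin-equality
        acc + u + e * D   ≡⟨ cong (_+ e * D) (+-comm acc u) ⟩
        u + acc + e * D   ≡⟨ +-assoc u acc (e * D) ⟩
        u + (acc + e * D) ≡⟨ cong (u +_) division ⟩
        u + u * k         ∎

    runs-phase₁ : Runs phase₁ initial Rounded
    runs-phase₁ =
      runs-seq $ runs-load address n refl size (fit (word address<U)) (fit (word n<U)) $
      runs-seq $ runs-assign (address + 1) refl (fit (word address<U +ˢ one)) $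
      runs-seq $ runs-load (address + 1) d refl dim (fit (word address<U +ˢ one)) (fit (word d<U)) $
      runs-seq $ runs-assign (n + 1) refl (fit (word n<U +ˢ one)) $
      runs-seq $ runs-assign u refl (fit u-small) $
      runs-seq $ runs-assign D refl (fit D-small) $
      runs-seq $ runs-assign 1 refl (fit one) $
      runs-seq $ runs-assign 2 refl (fit two) $
      runs-seq $ runs-assign 0 refl (fit (smaller z≤n one)) $
      runs-while Doubled runs-doubling
        (λ {k} {σ} (setting@(_ , _ , _ , _ , r7 , _) , e , r6 , r11 , round) ge →
          setting , k , e , r6 , subst₂ _≤_ (trans r7 (+-comm n 1)) r11 (≮⇒≥ ge) , regs σ 8 , round)
        ((refl , refl , refl , refl , refl , refl , refl , refl) , 0 , refl , refl ,
          rounding (sym (*-zeroʳ u)) (≤-trans 0<q (≤-trans (m≤m+n q _) (m≤m+n u p))) z≤n (m≤n⊔m n 1))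

  -- Second phase: writing the output

  module Filling (s : ℕ) .{{_ : NonZero s}} (s≤n⊔1 : s ≤ n ⊔ 1) where

    g G Q blocks cells : ℕ
    g = ⌈ n / s ⌉
    G = g * g
    Q = 2 + 2 * s
    blocks = G * Q
    cells = outputSize n s

    -- The last group is shifted back so that it also has s members.
    first : ℕ → ℕ
    first i = i * s ∸ (i * s ∸ (n ∸ s))

    -- Block `t` belongs to the pair of groups given by quotient and remainder of `t` by `g`; the
    -- remainder is spelled out with subtraction, as the machine computes it. A block holds the
    -- header `s`, `d`, then the pointers for `A`, then those for `B`.
    pointerCell blockCell : ℕ → ℕ → ℕ
    pointerCell t r = choose r s
      (memory (address + 2 + r + first (applyOp div t g)))
      (memory (address + 2 + n + (r ∸ s) + first (t ∸ applyOp div t g * g)))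
    blockCell t o = choose o 2 (choose o 1 s d) (pointerCell t (o ∸ 2))

    cell : ℕ → ℕ
    cell k = choose k blocks (blockCell (k / Q) (k ∸ k / Q * Q)) (free + (k ∸ blocks) * Q)

    first≡⊓ : ∀ i → first i ≡ i * s ⊓ (n ∸ s)
    first≡⊓ i = sym (m⊓n≡m∸[m∸n] (i * s) (n ∸ s))

    in-block : ∀ {t o} → t < G → o < Q → t * Q + o < blocks
    in-block {t} {o} t<G o<Q = begin-strict
      t * Q + o     <⟨ +-monoʳ-< (t * Q) o<Q ⟩
      t * Q + Q     ≡⟨ +-comm (t * Q) Q ⟩
      suc t * Q     ≤⟨ *-monoˡ-≤ Q t<G ⟩
      blocks        ∎
      where open ≤-Reasoning

    -- No group starts after `n ∸ s`, so each has room for `s` members.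
    window : ∀ i {r} → s ≤ n → r < s → r + first i < n
    window i {r} s≤n r<s = begin-strict
      r + first i   <⟨ +-monoˡ-< (first i) r<s ⟩
      s + first i   ≤⟨ +-monoʳ-≤ s (≤-trans (≤-reflexive (first≡⊓ i)) (m⊓n≤n (i * s) (n ∸ s))) ⟩
      s + (n ∸ s)   ≡⟨ m+[n∸m]≡n s≤n ⟩
      n             ∎
      where open ≤-Reasoning

    open Execution (U ^ wordLength) cells

    s-small : Small 1 s
    s-small = smaller s≤n⊔1 n⊔1-small

    n+s-small : Small 2 (n + s)
    n+s-small = word n<U +ˢ s-small

    g-small : Small 2 g
    g-small = smaller (≤-trans (applyOp-div-≤ (n + s ∸ 1) s) (m∸n≤m (n + s) 1)) n+s-small

    Q-small : Small 3 Q
    Q-small = two +ˢ two *ˢ s-small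

    cells-small : Small 8 cells
    cells-small = g-small *ˢ g-small *ˢ Q-small +ˢ g-small *ˢ g-small

    Setting₂ : State → Set
    Setting₂ σ = regs σ 0 ≡ G × regs σ 1 ≡ free + blocks × regs σ 2 ≡ address + 2 ×
      regs σ 3 ≡ free × regs σ 4 ≡ n × regs σ 5 ≡ d × regs σ 6 ≡ s × regs σ 12 ≡ g ×
      regs σ 13 ≡ Q × regs σ 14 ≡ blocks × regs σ 15 ≡ cells × regs σ 16 ≡ n ∸ s

    -- The bound on `v` is kept for the store that follows.
    Computed : ℕ → Memory → ℕ → State → Set
    Computed k m v σ = Setting₂ σ × regs σ 17 ≡ k × mem σ ≡ m × regs σ 20 ≡ v × v < U ^ wordLength

    -- Pointers are still read from the input while the output is being written, and the output
    -- shares the input's vectors.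
    InputIntact : Memory → Set
    InputIntact m = ∀ a → a < free → m a ≡ memory a

    -- Resolves a `choose` in the specification once the branch taken is known.
    relabel : ∀ {c σ k m v w} → w ≡ v → Runs c σ (Computed k m v) → Runs c σ (Computed k m w)
    relabel refl r = r

    -- The address read lies below `free`, where memory still equals the input, so the loaded value
    -- is an input word.
    runs-fetch : ∀ {k m σ} i b →
      Setting₂ σ → regs σ 17 ≡ k → mem σ ≡ m → InputIntact m →
      regs σ 23 ≡ i → regs σ 24 ≡ b → Small 8 i → b + first i < free →
      Runs fetch σ (Computed k m (memory (b + first i)))
    runs-fetch i b setting@(_ , _ , _ , _ , _ , _ , r6 , _ , _ , _ , _ , r16) r17 refl intact r23 r24 i-small b< =
      runs-seq $ runs-assign (i * s) (cong₂ _*_ r23 r6) (fit is-small) $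
      runs-seq $ runs-assign (i * s ∸ (n ∸ s)) (cong (i * s ∸_) r16) (fit (smaller (m∸n≤m (i * s) (n ∸ s)) is-small)) $
      runs-seq $ runs-assign (first i) refl (fit (smaller (m∸n≤m (i * s) (i * s ∸ (n ∸ s))) is-small)) $
      runs-seq $ runs-assign (b + first i) (cong (_+ first i) r24) (fit b+first-small) $
      runs-load _ _ refl (intact _ b<) (fit b+first-small) (fit (word (memory<U _)))
      (setting , r17 , refl , refl , fit (word (memory<U _)))
      where
      is-small : Small 9 (i * s)
      is-small = i-small *ˢ s-small
      b+first-small : Small 1 (b + first i)
      b+first-small = smaller (<⇒≤ b<) (word free<U)

    runs-pointer : ∀ {k m σ} t o →
      Setting₂ σ → regs σ 17 ≡ k → mem σ ≡ m → InputIntact m →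
      regs σ 21 ≡ t → regs σ 22 ≡ o → Small 8 t → o < Q → o ≮ 2 → s ≤ n →
      Runs pointer σ (Computed k m (pointerCell t (o ∸ 2)))
    runs-pointer {k} {m} {σ} t o setting@(_ , _ , r2 , _ , r4 , _ , r6 , r12 , _ , _ , _ , _)
      r17 refl intact r21 r22 t-small o<Q o≮2 s≤n =
      runs-seq $ runs-assign r (cong (_∸ 2) r22) (fit r-small) $
      runs-seq $ runs-assign i (cong₂ (applyOp div) r21 r12) (fit i-small) $
      runs-seq $ runs-if
        (λ lt →
          let r<s = subst (r <_) r6 lt in
          runs-assign (address + 2 + r) (cong (_+ r) r2) (fit (word address<U +ˢ two +ˢ r-small)) $
          relabel (choose-< r<s) $
          runs-fetch i (address + 2 + r) setting r17 refl intact refl refl i-small (begin-strict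
            address + 2 + r + first i     ≡⟨ +-assoc (address + 2) r (first i) ⟩
            address + 2 + (r + first i)   <⟨ +-monoʳ-< (address + 2) (window i s≤n r<s) ⟩
            address + 2 + n               ≤⟨ +-monoʳ-≤ (address + 2) (m≤m+n n n) ⟩
            address + 2 + (n + n)         ≤⟨ fits ⟩
            free                          ∎))
        (λ ge →
          let r≮s = subst (r ≮_) r6 ge
              r∸s<s = m<n+o⇒m∸n<o r s r<s+s in
          runs-seq $ runs-assign (i * g) (cong (i *_) r12) (fit (smaller (applyOp-div-*-≤ t g) t-small)) $
          runs-seq $ runs-assign j (cong (_∸ i * g) r21) (fit j-small) $
          runs-seq $ runs-assign (address + 2 + n) (cong₂ _+_ r2 r4) (fit (word address<U +ˢ two +ˢ word n<U)) $
          runs-seq $ runs-assign (r ∸ s) (cong (r ∸_) r6) (fit (smaller (m∸n≤m r s) r-small)) $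
          runs-assign (address + 2 + n + (r ∸ s)) refl
            (fit (word address<U +ˢ two +ˢ word n<U +ˢ smaller (m∸n≤m r s) r-small)) $
          relabel (choose-≮ r≮s) $
          runs-fetch j (address + 2 + n + (r ∸ s)) setting r17 refl intact refl refl j-small (begin-strict
            address + 2 + n + (r ∸ s) + first j     ≡⟨ +-assoc (address + 2 + n) (r ∸ s) (first j) ⟩
            address + 2 + n + (r ∸ s + first j)     <⟨ +-monoʳ-< (address + 2 + n) (window j s≤n r∸s<s) ⟩
            address + 2 + n + n                     ≡⟨ +-assoc (address + 2) n n ⟩
            address + 2 + (n + n)                   ≤⟨ fits ⟩
            free                                    ∎))
      where
      open ≤-Reasoning
      r = o ∸ 2
      i = applyOp div t g
      j = t ∸ i * g
      r-small : Small 3 r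
      r-small = smaller (≤-trans (m∸n≤m o 2) (<⇒≤ o<Q)) Q-small
      i-small : Small 8 i
      i-small = smaller (applyOp-div-≤ t g) t-small
      j-small : Small 8 j
      j-small = smaller (m∸n≤m t (i * g)) t-small
      r<s+s : r < s + s
      r<s+s = begin-strict
        o ∸ 2       <⟨ ∸-monoˡ-< o<Q (≮⇒≥ o≮2) ⟩
        2 * s       ≡⟨ cong (s +_) (+-identityʳ s) ⟩
        s + s       ∎

    k<blocks⇒0<g : ∀ {k} → k < blocks → 0 < g
    k<blocks⇒0<g k<blocks with g
    ... | suc _ = s≤s z≤n

    s≤n : 0 < g → s ≤ n
    s≤n = 0<⌈n/s⌉⇒s≤n n s s≤n⊔1

    runs-computeCell : ∀ {k σ} →
      Setting₂ σ → regs σ 17 ≡ k → InputIntact (mem σ) → k < cells →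
      Runs computeCell σ (Computed k (mem σ) (cell k))
    runs-computeCell {k} {σ} setting@(_ , _ , _ , r3 , _ , r5 , r6 , _ , r13 , r14 , _ , _) r17 intact k<cells =
      runs-if
        (λ lt →
          let k<blocks = subst₂ _<_ r17 r14 lt in
          relabel (choose-< k<blocks) $
          runs-seq $ runs-assign t (cong₂ (applyOp div) r17 r13) (fit t-small) $
          runs-seq $ runs-assign (t * Q) (cong (t *_) r13) (fit (smaller (m/n*n≤m k Q) k-small)) $
          runs-seq $ runs-assign o (cong (_∸ t * Q) r17) (fit (smaller (m∸n≤m k (t * Q)) k-small)) $
          runs-if
            (λ o<2 →
              relabel (choose-< o<2) $
              runs-if
                (λ o<1 → relabel (choose-< o<1) $
                  runs-assign s (trans (+-identityʳ _) r6) (fit s-small)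
                  (setting , r17 , refl , refl , fit s-small))
                (λ o≮1 → relabel (choose-≮ o≮1) $
                  runs-assign d (trans (+-identityʳ _) r5) (fit (word d<U))
                  (setting , r17 , refl , refl , fit (word d<U))))
            (λ o≮2 →
              relabel (choose-≮ o≮2) $
              runs-pointer t o setting r17 refl intact refl refl t-small o<Q o≮2 (s≤n (k<blocks⇒0<g k<blocks))))
        (λ ge →
          let k≮blocks = subst₂ _≮_ r17 r14 ge in
          relabel (choose-≮ k≮blocks) $
          runs-seq $ runs-assign (k ∸ blocks) (cong₂ _∸_ r17 r14) (fit k∸blocks-small) $
          runs-seq $ runs-assign ((k ∸ blocks) * Q) (cong ((k ∸ blocks) *_) r13) (fit (k∸blocks-small *ˢ Q-small)) $
          runs-assign (free + (k ∸ blocks) * Q) (cong (_+ (k ∸ blocks) * Q) r3) (fit pointer-small)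
          (setting , r17 , refl , refl , fit pointer-small))
      where
      t = k / Q
      o = k ∸ t * Q
      k-small : Small 8 k
      k-small = smaller (<⇒≤ k<cells) cells-small
      t-small : Small 8 t
      t-small = smaller (m/n≤m k Q) k-small
      k∸blocks≤G : k ∸ blocks ≤ G
      k∸blocks≤G = ≤-trans (∸-monoˡ-≤ blocks (<⇒≤ k<cells)) (≤-reflexive (m+n∸m≡n blocks G))
      k∸blocks-small : Small 4 (k ∸ blocks)
      k∸blocks-small = smaller k∸blocks≤G (g-small *ˢ g-small)
      pointer-small : Small 8 (free + (k ∸ blocks) * Q)
      pointer-small = word free<U +ˢ k∸blocks-small *ˢ Q-small
      o<Q : o < Q
      o<Q = subst (_< Q) (m%n≡m∸m/n*n k Q) (m%n<n k Q)

    Filled : ℕ → State → Set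
    Filled k σ = Setting₂ σ × InputIntact (mem σ) × (∀ j → j < k → mem σ (free + j) ≡ cell j)

    PartlyFilled : ℕ → State → Set
    PartlyFilled k σ = Filled k σ × regs σ 17 ≡ k × k ≤ cells

    runs-writeCell : ∀ {k σ} → PartlyFilled k σ → regs σ 17 < regs σ 15 →
      k < cells × Runs writeCell σ (PartlyFilled (suc k))
    runs-writeCell {k} {σ} ((setting@(_ , _ , _ , _ , _ , _ , _ , _ , _ , _ , r15 , _) , intact , filled) , r17 , _) lt =
      k<cells ,
      (runs-computeCell setting r17 intact k<cells ⟫
        λ {τ} (setting′@(_ , _ , _ , r3 , _) , r17′ , mem≡ , r20 , cell<W) →
          runs-seq $ runs-assign (free + k) (cong₂ _+_ r3 r17′) (fit free+k-small) $
          runs-seq $ runs-store (free + k) (cell k) refl r20 (fit free+k-small) cell<W $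
          runs-assign (suc k) (trans (cong (_+ 1) r17′) (+-comm k 1)) (fit (smaller k<cells cells-small))
          ((setting′ ,
            (λ a a<free → trans (update-≢ (mem τ) (cell k) (<⇒≢ (≤-trans a<free (m≤m+n free k))))
              (trans (cong-app mem≡ a) (intact a a<free))) ,
            extend τ mem≡) ,
           refl , k<cells))
      where
      k<cells : k < cells
      k<cells = subst₂ _<_ r17 r15 lt
      free+k-small : Small 9 (free + k)
      free+k-small = word free<U +ˢ smaller (<⇒≤ k<cells) cells-small
      extend : ∀ τ → mem τ ≡ mem σ → ∀ j → j < suc k → update (mem τ) (free + k) (cell k) (free + j) ≡ cell j
      extend τ mem≡ j j<1+k with j ≟ k
      ... | yes refl = update-≡ (mem τ) (free + j) (cell j)
      ... | no j≢k = trans (update-≢ (mem τ) (cell k) (j≢k ∘ +-cancelˡ-≡ free j k))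
                       (trans (cong-app mem≡ (free + j)) (filled j (≤∧≢⇒< (s≤s⁻¹ j<1+k) j≢k)))

    runs-phase₂ : ∀ {σ} → regs σ 2 ≡ address → regs σ 3 ≡ free → regs σ 4 ≡ n → regs σ 5 ≡ d →
      regs σ 6 ≡ s → mem σ ≡ memory → Runs phase₂ σ (Filled cells)
    runs-phase₂ r2 r3 r4 r5 r6 refl =
      runs-seq $ runs-assign (n + s) (cong₂ _+_ r4 r6) (fit n+s-small) $
      runs-seq $ runs-assign (n + s ∸ 1) refl (fit (smaller (m∸n≤m (n + s) 1) n+s-small)) $
      runs-seq $ runs-assign g (cong (applyOp div (n + s ∸ 1)) r6) (fit g-small) $
      runs-seq $ runs-assign G refl (fit (g-small *ˢ g-small)) $
      runs-seq $ runs-assign (2 * s) (cong (2 *_) r6) (fit (two *ˢ s-small)) $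
      runs-seq $ runs-assign Q refl (fit Q-small) $
      runs-seq $ runs-assign blocks refl (fit (g-small *ˢ g-small *ˢ Q-small)) $
      runs-seq $ runs-assign cells refl (fit cells-small) $
      runs-seq $ runs-assign (n ∸ s) (cong₂ _∸_ r4 r6) (fit (smaller (m∸n≤m n s) (word n<U))) $
      runs-seq $ runs-assign (address + 2) (cong (_+ 2) r2) (fit (word address<U +ˢ two)) $
      runs-seq $ runs-assign (free + blocks) (cong (_+ blocks) r3) (fit (word free<U +ˢ g-small *ˢ g-small *ˢ Q-small)) $
      runs-seq $ runs-assign 0 refl (fit (smaller z≤n one)) $
      runs-while PartlyFilled runs-writeCell
        (λ { ((setting@(_ , _ , _ , _ , _ , _ , _ , _ , _ , _ , r15 , _) , intact , filled) , r17 , k≤) ge →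
          setting , intact , λ j j< → filled j (<-≤-trans j< (subst₂ _≤_ r15 r17 (≮⇒≥ ge))) })
        (((refl , refl , refl , r3 , r4 , r5 , r6 , refl , refl , refl , refl , refl) ,
          (λ _ _ → refl) , λ _ ()) , refl , z≤n)

    -- Decoding cell numbers

    cell-in-block : ∀ {t o} → t < G → o < Q → cell (t * Q + o) ≡ blockCell t o
    cell-in-block {t} {o} t<G o<Q = begin
      cell (t * Q + o)
        ≡⟨ choose-< (in-block t<G o<Q) ⟩
      blockCell ((t * Q + o) / Q) (t * Q + o ∸ (t * Q + o) / Q * Q)
        ≡⟨ cong (λ t′ → blockCell t′ (t * Q + o ∸ t′ * Q)) ([m*n+o]/n≡m t Q o<Q) ⟩
      blockCell t (t * Q + o ∸ t * Q)
        ≡⟨ cong (blockCell t) (m+n∸m≡n (t * Q) o) ⟩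
      blockCell t o
        ∎
      where open ≡-Reasoning

    -- The block number has the form of `toℕ (combine a b)`, so that pairs of groups can be indexed
    -- by `Fin G`.
    pointerCell-A : ∀ (a b : Fin g) {r} → r < s →
      pointerCell (g * toℕ a + toℕ b) r ≡ memory (address + 2 + (r + first (toℕ a)))
    pointerCell-A a b {r} r<s = begin
      pointerCell t r
        ≡⟨ choose-< r<s ⟩
      memory (address + 2 + r + first (applyOp div t g))
        ≡⟨ cong (λ i → memory (address + 2 + r + first i)) (applyOp-div-combine a b) ⟩
      memory (address + 2 + r + first (toℕ a))
        ≡⟨ cong memory (+-assoc (address + 2) r _) ⟩
      memory (address + 2 + (r + first (toℕ a)))
        ∎
      where
      open ≡-Reasoning
      t = g * toℕ a + toℕ b

    pointerCell-B : ∀ (a b : Fin g) r →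
      pointerCell (g * toℕ a + toℕ b) (s + r) ≡ memory (address + 2 + n + (r + first (toℕ b)))
    pointerCell-B a b r = begin
      pointerCell t (s + r)
        ≡⟨ choose-≮ (≤⇒≯ (m≤m+n s r)) ⟩
      memory (address + 2 + n + (s + r ∸ s) + first (t ∸ applyOp div t g * g))
        ≡⟨ cong₂ (λ r′ i → memory (address + 2 + n + r′ + first (t ∸ i * g))) (m+n∸m≡n s r) (applyOp-div-combine a b) ⟩
      memory (address + 2 + n + r + first (t ∸ toℕ a * g))
        ≡⟨ cong (λ i → memory (address + 2 + n + r + first i))
             (trans (cong (t ∸_) (*-comm (toℕ a) g)) (m+n∸m≡n (g * toℕ a) (toℕ b))) ⟩
      memory (address + 2 + n + r + first (toℕ b))
        ≡⟨ cong memory (+-assoc (address + 2 + n) r _) ⟩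
      memory (address + 2 + n + (r + first (toℕ b)))
        ∎
      where
      open ≡-Reasoning
      t = g * toℕ a + toℕ b

    -- Groups and the instances formed from their pairs

    member : Fin g → Fin s → Fin n
    -- An element of `Fin g` witnesses `0 < g`, which yields `s ≤ n`.
    member i r = fromℕ< (window (toℕ i) (s≤n (≤-trans (s≤s z≤n) (toℕ<n i))) (toℕ<n r))

    toℕ-member : ∀ i r → toℕ (member i r) ≡ toℕ r + first (toℕ i)
    toℕ-member i r = toℕ-fromℕ< _

    member-injective : ∀ i → Injective _≡_ _≡_ (member i)
    member-injective i {r} {r′} eq = toℕ-injective (+-cancelʳ-≡ (first (toℕ i)) (toℕ r) (toℕ r′)
      (trans (sym (toℕ-member i r)) (trans (cong toℕ eq) (toℕ-member i r′))))

    -- Group `k / s` contains `k` even if it was shifted: the shift only moves its start to the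
    -- left, and not further than `n ∸ s`, so the group then extends up to `n`.
    member-surjective : ∀ k → ∃[ i ] ∃[ r ] member i r ≡ k
    member-surjective k = fromℕ< i<g , fromℕ< r<s , toℕ-injective (begin-equality
      toℕ (member (fromℕ< i<g) (fromℕ< r<s))           ≡⟨ toℕ-member (fromℕ< i<g) (fromℕ< r<s) ⟩
      toℕ (fromℕ< r<s) + first (toℕ (fromℕ< i<g))
        ≡⟨ cong₂ (λ r i → r + first i) (toℕ-fromℕ< r<s) (toℕ-fromℕ< i<g) ⟩
      toℕ k ∸ first i + first i                        ≡⟨ m∸n+n≡m first≤k ⟩
      toℕ k                                            ∎)
      where
      open ≤-Reasoning
      i = toℕ k / s
      i<g : i < g
      i<g = m<n*o⇒m/o<n (<-≤-trans (toℕ<n k) (n≤⌈n/s⌉*s n s))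
      i*s≤k : i * s ≤ toℕ k
      i*s≤k = m/n*n≤m (toℕ k) s
      first≤k : first i ≤ toℕ k
      first≤k = ≤-trans (m∸n≤m (i * s) (i * s ∸ (n ∸ s))) i*s≤k
      k<s+first : toℕ k < s + first i
      k<s+first = begin-strict
        toℕ k                           <⟨ ⊓-glb k<s+i*s (≤-trans (toℕ<n k) (m≤n+m∸n n s)) ⟩
        (s + i * s) ⊓ (s + (n ∸ s))     ≡⟨ +-distribˡ-⊓ s (i * s) (n ∸ s) ⟨
        s + i * s ⊓ (n ∸ s)             ≡⟨ cong (s +_) (first≡⊓ i) ⟨
        s + first i                     ∎
        where
        k<s+i*s : toℕ k < s + i * s
        k<s+i*s = begin-strict
          toℕ k                         ≡⟨ m≡m%n+[m/n]*n (toℕ k) s ⟩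
          toℕ k % s + i * s             <⟨ +-monoˡ-< (i * s) (m%n<n (toℕ k) s) ⟩
          s + i * s                     ∎
      r<s : toℕ k ∸ first i < s
      r<s = m<n+o⇒m∸n<o (toℕ k) (first i) (subst (toℕ k <_) (+-comm s _) k<s+first)

    subinstance : Fin g → Fin g → OVInstance s
    subinstance a b = record
      { A     = A ∘ member a
      ; B     = B ∘ member b
      ; A-inj = member-injective a ∘ A-inj
      ; B-inj = member-injective b ∘ B-inj
      }

    output : Fin G → OVInstance s
    output i = subinstance (proj₁ (remQuot {g} g i)) (proj₂ (remQuot {g} g i))

    -- The groups cover all indices, so every pair of vectors meets in some pair of groups.
    -- Conversely, all vectors of an output are input vectors.
    output-correct : HasOrthogonalPair inst ⇔ (∃[ i ] HasOrthogonalPair (output i))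
    output-correct = mk⇔ to λ (i , j , k , a⊥b) → _ , _ , a⊥b
      where
      to : HasOrthogonalPair inst → ∃[ i ] HasOrthogonalPair (output i)
      to (j , k , a⊥b) with member-surjective j | member-surjective k
      ... | a , r , refl | b , r′ , refl =
        combine a b , subst (λ (a , b) → HasOrthogonalPair (subinstance a b))
          (sym (remQuot-combine a b)) (r , r′ , a⊥b)

    -- The output instances in the final memory

    module _ {σ} (filled : Filled cells σ) where
      private
        intact = proj₁ (proj₂ filled)
        written = proj₂ (proj₂ filled)

      block-written : ∀ {t o v} → t < G → o < Q → blockCell t o ≡ v → mem σ (free + t * Q + o) ≡ v
      block-written {t} {o} {v} t<G o<Q eq = begin
        mem σ (free + t * Q + o)     ≡⟨ cong (mem σ) (+-assoc free (t * Q) o) ⟩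
        mem σ (free + (t * Q + o))   ≡⟨ written _ (<-≤-trans (in-block t<G o<Q) (m≤m+n blocks G)) ⟩
        cell (t * Q + o)             ≡⟨ cell-in-block t<G o<Q ⟩
        blockCell t o                ≡⟨ eq ⟩
        v                            ∎
        where open ≡-Reasoning

      table-written : ∀ (i : Fin G) → mem σ (free + blocks + toℕ i) ≡ free + toℕ i * Q
      table-written i = begin
        mem σ (free + blocks + toℕ i)     ≡⟨ cong (mem σ) (+-assoc free blocks (toℕ i)) ⟩
        mem σ (free + (blocks + toℕ i))   ≡⟨ written _ (+-monoʳ-< blocks (toℕ<n i)) ⟩
        cell (blocks + toℕ i)             ≡⟨ choose-≮ (≤⇒≯ (m≤m+n blocks (toℕ i))) ⟩
        free + (blocks + toℕ i ∸ blocks) * Q ≡⟨ cong (λ j → free + j * Q) (m+n∸m≡n blocks (toℕ i)) ⟩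
        free + toℕ i * Q                  ∎
        where open ≡-Reasoning

      -- Input vectors lie entirely below `free` and are never overwritten.
      vector-kept : ∀ {p p′ d} (v : Vec Bool d) → p ≡ p′ → VectorAt free memory p′ v →
        VectorAt (U ^ wordLength) (mem σ) p v
      vector-kept v refl (p+d≤free , bits) =
        ≤-trans p+d≤free (<⇒≤ (fit (word free<U))) ,
        λ j → trans (intact _ (<-≤-trans (+-monoʳ-< _ (toℕ<n j)) p+d≤free)) (bits j)

      subinstance-represented : ∀ a b →
        OVRepresents (U ^ wordLength) (mem σ) (free + (g * toℕ a + toℕ b) * Q) (subinstance a b)
      subinstance-represented a b = record
        { fits  = begin
            base + 2 + (s + s)            ≡⟨ +-assoc base 2 (s + s) ⟩
            base + (2 + (s + s))          ≡⟨ cong (λ m → base + (2 + (s + m))) (+-identityʳ s) ⟨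
            free + t * Q + Q              ≡⟨ +-assoc free (t * Q) Q ⟩
            free + (t * Q + Q)            ≡⟨ cong (free +_) (+-comm (t * Q) Q) ⟩
            free + suc t * Q              ≤⟨ +-monoʳ-≤ free (≤-trans (*-monoˡ-≤ Q t<G) (m≤m+n blocks G)) ⟩
            free + cells                  ≤⟨ <⇒≤ (fit (word free<U +ˢ cells-small)) ⟩
            U ^ wordLength                ∎
        ; size  = trans (cong (mem σ) (sym (+-identityʳ base))) (block-written t<G (s≤s z≤n) refl)
        ; dim   = block-written t<G (s≤s (s≤s z≤n)) refl
        ; vecsA = λ r → vector-kept (A (member a r))
            (begin-equality
              mem σ (base + 2 + toℕ r)                        ≡⟨ cong (mem σ) (+-assoc base 2 (toℕ r)) ⟩
              mem σ (base + (2 + toℕ r))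
                ≡⟨ block-written t<G (2+r<Q (≤-trans (toℕ<n r) (m≤m+n s s))) (pointerCell-A a b (toℕ<n r)) ⟩
              memory (address + 2 + (toℕ r + first (toℕ a)))
                ≡⟨ cong (λ i → memory (address + 2 + i)) (toℕ-member a r) ⟨
              memory (address + 2 + toℕ (member a r))         ∎)
            (vecsA (member a r))
        ; vecsB = λ r → vector-kept (B (member b r))
            (begin-equality
              mem σ (base + 2 + s + toℕ r)
                ≡⟨ cong (mem σ) (trans (+-assoc (base + 2) s (toℕ r)) (+-assoc base 2 _)) ⟩
              mem σ (base + (2 + (s + toℕ r)))
                ≡⟨ block-written t<G (2+r<Q (+-monoʳ-< s (toℕ<n r))) (pointerCell-B a b (toℕ r)) ⟩
              memory (address + 2 + n + (toℕ r + first (toℕ b)))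
                ≡⟨ cong (λ i → memory (address + 2 + n + i)) (toℕ-member b r) ⟨
              memory (address + 2 + n + toℕ (member b r))         ∎)
            (vecsB (member b r))
        }
        where
        open ≤-Reasoning
        t = g * toℕ a + toℕ b
        base = free + t * Q
        t<G : t < G
        t<G = subst (_< G) (toℕ-combine a b) (toℕ<n (combine a b))
        2+r<Q : ∀ {r} → r < s + s → 2 + r < Q
        2+r<Q {r} r< = +-monoʳ-< 2 (subst (r <_) (cong (s +_) (sym (+-identityʳ s))) r<)

      output-represented : ∀ i →
        OVRepresents (U ^ wordLength) (mem σ) (mem σ (free + blocks + toℕ i)) (output i)
      output-represented i = subst
        (λ m → OVRepresents (U ^ wordLength) (mem σ) m (output i))
        (trans (cong (λ j → free + j * Q) (trans (sym (toℕ-combine a b)) (cong toℕ (combine-remQuot {g} g i))))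
          (sym (table-written i)))
        (subinstance-represented a b)
        where
        a = proj₁ (remQuot {g} g i)
        b = proj₂ (remQuot {g} g i)

-- Keeps, next to the outcome, the facts about `e` that the bounds rely on and that `Outcome` does
-- not expose.
record Decomposition {lam} (x : Input OrthogonalVectors lam) : Set where
  open Input x using (n)
  field
    outcome   : Outcome OrthogonalVectors program wordLength x
    {k e acc} : ℕ
    rounded   : Rounding n (2 * ↧ₙ lam) (2 * ↧ₙ lam + ∣ ↥ lam ∣) k e acc
    n<2^1+k   : n < 2 ^ suc k
    count≡    : Outcome.count outcome ≡ ⌈ n / 2 ^ e ⌉ * ⌈ n / 2 ^ e ⌉
    param≡    : ∀ i → Outcome.param outcome i ≡ 2 ^ e
    steps≤    : Outcome.steps outcome ≤ cost n phase₁ + cost (outputSize n (2 ^ e)) phase₂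

module _ {lam} (x : Input OrthogonalVectors lam) where
  open Input x
  open OnInput x hiding (p; q; u; D)
  open Words U 2≤U

  module _ {k e acc} (rounded : Rounding n (2 * ↧ₙ lam) (2 * ↧ₙ lam + ∣ ↥ lam ∣) k e acc)
    (n<2^1+k : n < 2 ^ suc k) where
    open Filling (2 ^ e) {{m^n≢0 2 e}} (2^e≤n⊔1 rounded)

    assemble : ∀ {σ t} → U ^ wordLength ⊢ phase₁ , initial ⇓ σ , t → t ≤ cost n phase₁ →
      Execution.Runs (U ^ wordLength) cells phase₂ σ (Filled cells) → Decomposition x
    assemble run₁ t₁≤ (τ , (_ , run₂ , t₂≤) , filled@((r0 , r1 , _) , _)) = record
      { outcome = record
        { final      = τ
        ; halts      = ⇓seq run₁ run₂
        ; table-fits = subst (_≤ U ^ wordLength)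
            (trans (sym (+-assoc free blocks G)) (sym (cong₂ _+_ r1 r0)))
            (<⇒≤ (fit (word free<U +ˢ cells-small)))
        ; param      = λ _ → 2 ^ e
        -- The count is read off register 0 and equals `G` only propositionally, hence the casts.
        ; output     = λ i → output (cast r0 i)
        ; encoded    = λ i → subst (λ m → OVRepresents (U ^ wordLength) (mem τ) (mem τ m) (output (cast r0 i)))
            (cong₂ _+_ (sym r1) (toℕ-cast r0 i)) (output-represented {τ} filled (cast r0 i))
        ; correct    = mk⇔
            (λ yes-inst → let i , yes-i = Equivalence.to output-correct yes-inst in
              cast (sym r0) i , subst (HasOrthogonalPair ∘ output) (sym (cast-involutive r0 (sym r0) i)) yes-i)
            (λ (i , yes-i) → Equivalence.from output-correct (cast r0 i , yes-i))
        }
      ; rounded = rounded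
      ; n<2^1+k = n<2^1+k
      ; count≡  = r0
      ; param≡  = λ _ → refl
      ; steps≤  = +-mono-≤ t₁≤ t₂≤
      }

  decompose-after-phase₁ : Execution.Runs (U ^ wordLength) n phase₁ initial Rounded → Decomposition x
  decompose-after-phase₁ (_ , (_ , run₁ , t₁≤) , (r2 , r3 , r4 , r5 , _ , _ , _ , mem≡) , _ , e , r6 , n<2^1+k , _ , rounded) =
    assemble rounded n<2^1+k run₁ t₁≤
      (Filling.runs-phase₂ (2 ^ e) {{m^n≢0 2 e}}
        (2^e≤n⊔1 rounded) r2 r3 r4 r5 r6 mem≡)

  -- Abstract, so that type checking the bounds does not run the program.
  abstract
    decompose : Decomposition x
    decompose = decompose-after-phase₁ runs-phase₁

-- Soft-O bounds

^-distribʳ-* : ∀ k m n → (m * n) ^ k ≡ m ^ k * n ^ k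
^-distribʳ-* zero    m n = refl
^-distribʳ-* (suc k) m n = trans (cong (m * n *_) (^-distribʳ-* k m n)) ([m*n]*[o*p]≡[m*o]*[n*p] m n (m ^ k) (n ^ k))

cost-phases : ∀ {m n M} → 1 ≤ M → m ≤ M → n ≤ 5 * M →
  cost m phase₁ + cost n phase₂ ≤ 175 * M
cost-phases {m} {n} {M} 1≤M m≤M n≤5M = begin
  -- The evaluated costs: an iteration takes at most 7 steps in the first phase and 29 in the
  -- second, guard included.
  10 + m * 7 + (13 + n * 29)            ≡⟨ rearrange m n ⟩
  23 * 1 + 7 * m + 29 * n
    ≤⟨ +-mono-≤ (+-mono-≤ (*-monoʳ-≤ 23 1≤M) (*-monoʳ-≤ 7 m≤M)) (*-monoʳ-≤ 29 n≤5M) ⟩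
  23 * M + 7 * M + 29 * (5 * M)         ≡⟨ total M ⟩
  175 * M                               ∎
  where
  open ≤-Reasoning
  rearrange : ∀ m n → 10 + m * 7 + (13 + n * 29) ≡ 23 * 1 + 7 * m + 29 * n
  rearrange = solve-∀
  total : ∀ M → 23 * M + 7 * M + 29 * (5 * M) ≡ 175 * M
  total = solve-∀

-- Estimates for λ = p/q, raised to the power `D` to avoid fractional exponents

module Estimates {n k e acc} p q (1≤n : 1 ≤ n)
  (rounded : Rounding n (2 * q) (2 * q + p) k e acc) (n<2^1+k : n < 2 ^ suc k) where
  open Rounding rounded
  private
    u D s g : ℕ
    u = 2 * q
    D = u + p
    s = 2 ^ e
    g = ⌈ n / s ⌉

    instance
      n-nonZero : NonZero n
      n-nonZero = >-nonZero 1≤n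

      s-nonZero : NonZero s
      s-nonZero = m^n≢0 2 e

    2^k≤n : 2 ^ k ≤ n
    2^k≤n = subst (2 ^ k ≤_) (m≥n⇒m⊔n≡m 1≤n) 2^k≤n⊔1

    s≤n : s ≤ n
    s≤n = ≤-trans (^-monoʳ-≤ 2 e≤k) 2^k≤n

  open ≤-Reasoning

  -- Dropping the remainder of the division leaves `e * D ≤ u * k`.
  s^D≤n^2q : s ^ D ≤ n ^ u
  s^D≤n^2q = begin
    (2 ^ e) ^ D     ≡⟨ ^-*-assoc 2 e D ⟩
    2 ^ (e * D)     ≤⟨ ^-monoʳ-≤ 2 (≤-trans (m≤n+m (e * D) acc) (≤-reflexive (trans division (*-comm u k)))) ⟩
    2 ^ (k * u)     ≡⟨ ^-*-assoc 2 k u ⟨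
    (2 ^ k) ^ u     ≤⟨ ^-monoˡ-≤ u 2^k≤n ⟩
    n ^ u           ∎

  -- Each of the two roundings costs a factor 2 in `s`: replacing the logarithm by `k` adds `u ≤ D`
  -- to the exponent of 2, and the remainder `acc` adds less than `D`.
  n^2q≤[4s]^D : n ^ u ≤ (2 ^ (2 + e)) ^ D
  n^2q≤[4s]^D = begin
    n ^ u                   ≤⟨ ^-monoˡ-≤ u (<⇒≤ n<2^1+k) ⟩
    (2 ^ suc k) ^ u         ≡⟨ ^-*-assoc 2 (suc k) u ⟩
    2 ^ (u + k * u)         ≡⟨ cong (λ m → 2 ^ (u + m)) (trans (*-comm k u) (sym division)) ⟩
    2 ^ (u + (acc + e * D)) ≤⟨ ^-monoʳ-≤ 2 (+-mono-≤ (m≤m+n u p) (+-monoˡ-≤ (e * D) (<⇒≤ acc<D))) ⟩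
    2 ^ ((2 + e) * D)       ≡⟨ ^-*-assoc 2 (2 + e) D ⟨
    (2 ^ (2 + e)) ^ D       ∎

  g*4s≤8n : g * 2 ^ (2 + e) ≤ 8 * n
  g*4s≤8n = begin
    g * (2 * (2 * s))     ≡⟨ rearrange g s ⟩
    4 * (g * s)           ≤⟨ *-monoʳ-≤ 4 (≤-trans (⌈n/s⌉*s≤n+s n s) (+-monoʳ-≤ n s≤n)) ⟩
    4 * (n + n)           ≡⟨ double n ⟩
    8 * n                 ∎
    where
    rearrange : ∀ g s → g * (2 * (2 * s)) ≡ 4 * (g * s)
    rearrange = solve-∀
    double : ∀ n → 4 * (n + n) ≡ 8 * n
    double = solve-∀

  -- Since `D = u + p`, multiplying by `n ^ u` and trading it for the power of `4s` reduces the
  -- claim to `g*4s≤8n`.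
  g^D≤8^D*n^p : g ^ D ≤ 8 ^ D * n ^ p
  g^D≤8^D*n^p = *-cancelʳ-≤ _ _ (n ^ u) {{m^n≢0 n u}} (begin
    g ^ D * n ^ u                   ≤⟨ *-monoʳ-≤ (g ^ D) n^2q≤[4s]^D ⟩
    g ^ D * (2 ^ (2 + e)) ^ D       ≡⟨ ^-distribʳ-* D g (2 ^ (2 + e)) ⟨
    (g * 2 ^ (2 + e)) ^ D           ≤⟨ ^-monoˡ-≤ D g*4s≤8n ⟩
    (8 * n) ^ D                     ≡⟨ ^-distribʳ-* D 8 n ⟩
    8 ^ D * n ^ D                   ≡⟨ cong (8 ^ D *_) (trans (^-distribˡ-+-* n u p) (*-comm (n ^ u) (n ^ p))) ⟩
    8 ^ D * (n ^ p * n ^ u)         ≡⟨ *-assoc (8 ^ D) (n ^ p) (n ^ u) ⟨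
    8 ^ D * n ^ p * n ^ u           ∎)

  [g*g]^D≤64^D*n^2p : (g * g) ^ D ≤ 64 ^ D * n ^ (2 * p)
  [g*g]^D≤64^D*n^2p = begin
    (g * g) ^ D                             ≡⟨ ^-distribʳ-* D g g ⟩
    g ^ D * g ^ D                           ≤⟨ *-mono-≤ g^D≤8^D*n^p g^D≤8^D*n^p ⟩
    8 ^ D * n ^ p * (8 ^ D * n ^ p)         ≡⟨ [m*n]*[o*p]≡[m*o]*[n*p] (8 ^ D) (n ^ p) (8 ^ D) (n ^ p) ⟩
    8 ^ D * 8 ^ D * (n ^ p * n ^ p)         ≡⟨ cong₂ _*_ (^-distribʳ-* D 8 8) (^-distribˡ-+-* n p p) ⟨
    64 ^ D * n ^ (p + p)                    ≡⟨ cong (λ m → 64 ^ D * n ^ (p + m)) (+-identityʳ p) ⟨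
    64 ^ D * n ^ (2 * p)                    ∎

  -- The pointers dominate: the output has at most `5 * (g * g * s)` cells, and
  -- `n ≤ g * s ≤ g * g * s` covers the first phase.
  cost≤ : cost n phase₁ + cost (outputSize n s) phase₂ ≤ 175 * (g * g * s)
  cost≤ = cost-phases (≤-trans 1≤n n≤ggs) n≤ggs (begin
    g * g * (2 + 2 * s) + g * g           ≡⟨ expand (g * g) s ⟩
    3 * (g * g) + 2 * (g * g * s)         ≤⟨ +-monoˡ-≤ (2 * (g * g * s)) (*-monoʳ-≤ 3 (m≤m*n (g * g) s)) ⟩
    3 * (g * g * s) + 2 * (g * g * s)     ≡⟨ *-distribʳ-+ (g * g * s) 3 2 ⟨
    5 * (g * g * s)                       ∎)
    where
    0<g : 0 < g
    0<g = n≢0⇒n>0 λ g≡0 → contradiction (≤-trans 1≤n (≤-trans (n≤⌈n/s⌉*s n s) (≤-reflexive (cong (_* s) g≡0)))) λ ()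
    n≤ggs : n ≤ g * g * s
    n≤ggs = ≤-trans (n≤⌈n/s⌉*s n s) (*-monoˡ-≤ s (m≤n*m g g {{>-nonZero 0<g}}))
    expand : ∀ G s → G * (2 + 2 * s) + G ≡ 3 * G + 2 * (G * s)
    expand = solve-∀

  [c*ggs]^D≤ : ∀ c → (c * (g * g * s)) ^ D ≤ (c * 64) ^ D * n ^ (2 * p + u)
  [c*ggs]^D≤ c = begin
    (c * (g * g * s)) ^ D                       ≡⟨ ^-distribʳ-* D c (g * g * s) ⟩
    c ^ D * (g * g * s) ^ D                     ≡⟨ cong (c ^ D *_) (^-distribʳ-* D (g * g) s) ⟩
    c ^ D * ((g * g) ^ D * s ^ D)               ≤⟨ *-monoʳ-≤ (c ^ D) (*-mono-≤ [g*g]^D≤64^D*n^2p s^D≤n^2q) ⟩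
    c ^ D * (64 ^ D * n ^ (2 * p) * n ^ u)      ≡⟨ cong (c ^ D *_) (*-assoc (64 ^ D) _ _) ⟩
    c ^ D * (64 ^ D * (n ^ (2 * p) * n ^ u))    ≡⟨ *-assoc (c ^ D) (64 ^ D) _ ⟨
    c ^ D * 64 ^ D * (n ^ (2 * p) * n ^ u)      ≡⟨ cong₂ _*_ (^-distribʳ-* D c 64) (^-distribˡ-+-* n (2 * p) u) ⟨
    (c * 64) ^ D * n ^ (2 * p + u)              ∎

-- A record, so that the bases and exponents can be read off its type.
record PowerBound (m K n u v : ℕ) : Set where
  constructor powerBound
  field bound : m ^ v ≤ K ^ v * n ^ u

-- Unnormalised rationals do not cancel: the exponent of the count bound arises as a fraction
-- expanded by the denominator of λ.
powerBound-* : ∀ {m K n u v} k → PowerBound m K n u v → PowerBound m K n (u * k) (v * k)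
powerBound-* {m} {K} {n} {u} {v} k (powerBound m≤) = powerBound (begin
  m ^ (v * k)                   ≡⟨ ^-*-assoc m v k ⟨
  (m ^ v) ^ k                   ≤⟨ ^-monoˡ-≤ k m≤ ⟩
  (K ^ v * n ^ u) ^ k           ≡⟨ ^-distribʳ-* k (K ^ v) (n ^ u) ⟩
  (K ^ v) ^ k * (n ^ u) ^ k     ≡⟨ cong₂ _*_ (^-*-assoc K v k) (^-*-assoc n u k) ⟩
  K ^ (v * k) * n ^ (u * k)     ∎)
  where open ≤-Reasoning

-- The factor 1 is the zeroth power of the logarithmic term; all bounds hold without polylogarithmic
-- factors.
≤-powerBound : ∀ {m K n u v u′ v′} → PowerBound m K n u v → v ≡ v′ → u ≡ u′ →
  m ^ v′ ≤ (K * 1) ^ v′ * n ^ u′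
≤-powerBound {m} {K} {n} {u} {v} (powerBound m≤) refl refl =
  subst (λ C → m ^ v ≤ C ^ v * n ^ u) (sym (*-identityʳ K)) m≤

module _ {lam} {x : Input OrthogonalVectors lam} (δ : Decomposition x) (1≤n : 1 ≤ Input.n x) where
  open Decomposition δ
  open Outcome outcome
  open Input x using (n)
  open Estimates ∣ ↥ lam ∣ (↧ₙ lam) 1≤n rounded n<2^1+k
  private
    p q D : ℕ
    p = ∣ ↥ lam ∣
    q = ↧ₙ lam
    D = 2 * q + p

  steps-bound : PowerBound steps 11200 n (2 * p + 2 * q) D
  -- Here 11200 is 175 times 64.
  steps-bound = powerBound (≤-trans (^-monoˡ-≤ D (≤-trans steps≤ cost≤)) ([c*ggs]^D≤ 175))

  count-bound : PowerBound count 64 n (2 * p) D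
  count-bound = powerBound (subst (λ m → m ^ D ≤ 64 ^ D * n ^ (2 * p)) (sym count≡) [g*g]^D≤64^D*n^2p)

  param-bound : ∀ i → PowerBound (param i) 1 n (2 * q) D
  param-bound i = powerBound (begin
    param i ^ D             ≡⟨ cong (_^ D) (param≡ i) ⟩
    (2 ^ e) ^ D             ≤⟨ s^D≤n^2q ⟩
    n ^ (2 * q)             ≡⟨ trans (cong (_* n ^ (2 * q)) (^-zeroˡ D)) (*-identityˡ _) ⟨
    1 ^ D * n ^ (2 * q)     ∎)
    where open ≤-Reasoning

lemma3p1 : OR-Decomposable 2ℚᵘ OrthogonalVectors
lemma3p1 = record
  { 1<α         = ℚᵘ.*<* (ℤ.+<+ (s≤s (s≤s z≤n)))
  ; program     = program
  ; c           = wordLength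
  ; run         = λ _ _ x → Decomposition.outcome (decompose x)
  ; time-bound  = λ { (mkℚᵘ (ℤ.+ suc p-1) q-1) _ →
      -- The exponent is (2p + 2q)/(2q + p); `mkℚᵘ` takes the predecessor of the denominator.
      mkℚᵘ (ℤ.+ (2 * suc p-1 + 2 * suc q-1)) (pred (2 * suc q-1 + suc p-1)) ,
      ℚᵘ.*<* (ℤ.+<+ (time-exponent<2 (suc p-1) q-1)) ,
      11200 , 0 , λ x 1≤n → ≤-powerBound (steps-bound (decompose x) 1≤n) refl refl }
  ; count-bound = λ { (mkℚᵘ (ℤ.+ suc p-1) q-1) _ → 64 , 0 , λ x 1≤n →
      ≤-powerBound (powerBound-* (suc q-1) (count-bound (decompose x) 1≤n))
        (count-denominator p-1 q-1) (count-numerator p-1 q-1) }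
  ; size-bound  = λ { (mkℚᵘ (ℤ.+ suc p-1) q-1) _ → 1 , 0 , λ (x , i) 1≤n →
      ≤-powerBound (param-bound (decompose x) 1≤n i)
        (size-denominator p-1 q-1) (size-numerator p-1 q-1) }
  }
  where
  count-denominator : ∀ p q → (2 * suc q + suc p) * suc q ≡ (1 * suc q) * (2 * suc q + suc p * 1)
  count-denominator = solve-∀
  count-numerator : ∀ p q → 2 * suc p * suc q ≡ (2 * suc p) * (1 * suc q)
  count-numerator = solve-∀
  size-denominator : ∀ p q → 2 * suc q + suc p ≡ 1 * (2 * suc q + suc p * 1)
  size-denominator = solve-∀
  size-numerator : ∀ p q → 2 * suc q ≡ 2 * (1 * suc q)
  size-numerator = solve-∀
  -- The two sides differ by `2 * suc q`, which is positive for every λ.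
  time-exponent<2 : ∀ p q → (2 * p + 2 * suc q) * 1 < 2 * (2 * suc q + p)
  time-exponent<2 p q = subst (suc ((2 * p + 2 * suc q) * 1) ≤_) (gap p q) (m≤m+n _ (suc (2 * q)))
    where
    gap : ∀ p q → suc ((2 * p + 2 * suc q) * 1) + suc (2 * q) ≡ 2 * (2 * suc q + p)
    gap = solve-∀
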